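{- Fix $n$ and a simple graph $S$. Let $G$ be a bridge sum of $S$ with the complete graph $K$ on $n$ vertices, and let $\sigma$ be any labeling of $G$. Then the length of the orbit of toric promotion containing the state $(\sigma,i)$ depends only on $n$, $S$, and $\phi$, the restriction of $\sigma$ to (the vertices of) $S$.
   Context: Toric promotion. Let $G=(V,E)$ be a simple graph (undirected, unweighted, no self-loops, no multiple edges) on $N$ vertices. A labeling of $G$ is a bijection $\sigma:V\to\mathbb{Z}/N\mathbb{Z}=\{1,\dots,N\}$ (addition modulo $N$). A state is a pair $(\sigma,i)$ with $\sigma$ a labeling of $G$ and $i\in\mathbb{Z}/N\mathbb{Z}$; $\Omega_G$ is the set of all states. Toric promotion is the map $\mathrm{TPro}:\Omega_G\to\Omega_G$ given by $\mathrm{TPro}(\sigma,i)=(\sigma,i+1)$ if $\{\sigma^{ -1}(i),\sigma^{ -1}(i+1)\}\in E$, and $\mathrm{TPro}(\sigma,i)=((i,i+1)\circ\sigma,\,i+1)$ if $\{\sigma^{ -1}(i),\sigma^{ -1}(i+1)\}\notin E$, where $(i,i+1)$ is the involution swapping the labels $i$ and $i+1$. It is a bijection of $\Omega_G$. The length of the orbit containing $(\sigma,i)$ is the minimum number (at least one) of iterations of $\mathrm{TPro}$ required to get from $(\sigma,i)$ back to $(\sigma,i)$. Bridge sum. For graphs $G_1=(V_1,E_1)$, $G_2=(V_2,E_2)$ (with disjoint vertex sets) and vertices $v_1\in V_1$, $v_2\in V_2$, the bridge sum of $G_1$ and $G_2$ at $v_1$ and $v_2$ is the graph with vertex set $V_1\cup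 V_2$ and edge set $E_1\cup E_2\cup\{\{v_1,v_2\}\}$. "A bridge sum" of two graphs means a bridge sum at any two vertices, one from each graph.
   Formalization: The index i and the vertex of S at which the bridge is attached are held fixed: the length may depend on them as well as on n, S and φ. Without this the claim fails, e.g. for S two isolated vertices and n = 1. -}

module Defs where

open import Data.Fin.Base using (Fin; toℕ)
open import Data.Fin.Permutation using (transpose)
import Data.Fin.Properties as Fin
open import Data.Nat.Base using (ℕ; suc; _≤_)
open import Data.Nat.DivMod using (_mod_)
open import Data.Nat.GeneralisedArithmetic using (iterate)
open import Data.Product.Base using (_×_; _,_)
open import Data.Sum.Base using (_⊎_; inj₁; inj₂)
open import Function.Base using (_∘_)
open import Function.Bundles using (_↔_; Inverse)
open import Function.Properties.Inverse using (↔-trans)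
open import Level using (0ℓ)
open import Relation.Binary.Core using (Rel)
open import Relation.Binary.Definitions
  using (Decidable; DecidableEquality; Symmetric)
open import Relation.Binary.PropositionalEquality.Core
  using (_≡_; _≢_; refl; _≗_; ≢-sym)
open import Relation.Nullary using (¬_; yes; no; ¬?)
open import Relation.Nullary.Decidable using (_×-dec_)

-- Adjacency is decidable because toric promotion branches on it.
record SimpleGraph (V : Set) : Set₁ where
  field
    Adj    : Rel V 0ℓ
    adj?   : Decidable Adj
    sym    : Symmetric Adj
    irrefl : ∀ {v} → ¬ Adj v v

open SimpleGraph public using (Adj; adj?)

complete : (n : ℕ) → SimpleGraph (Fin n)
complete n = record
  { Adj    = _≢_
  ; adj?   = λ i j → ¬? (i Fin.≟ j)
  ; sym    = ≢-sym
  ; irrefl = λ v≢v → v≢v refl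
  }

module _ {V₁ V₂ : Set} (G₁ : SimpleGraph V₁) (G₂ : SimpleGraph V₂)
         (v₁ : V₁) (v₂ : V₂) where

  BridgeAdj : Rel (V₁ ⊎ V₂) 0ℓ
  BridgeAdj (inj₁ x) (inj₁ y) = Adj G₁ x y
  BridgeAdj (inj₁ x) (inj₂ y) = x ≡ v₁ × y ≡ v₂
  BridgeAdj (inj₂ x) (inj₁ y) = y ≡ v₁ × x ≡ v₂
  BridgeAdj (inj₂ x) (inj₂ y) = Adj G₂ x y

  bridgeSum : DecidableEquality V₁ → DecidableEquality V₂ →
              SimpleGraph (V₁ ⊎ V₂)
  bridgeSum _≟₁_ _≟₂_ = record
    { Adj    = BridgeAdj
    ; adj?   = dec
    ; sym    = λ {x} {y} → symm x y
    ; irrefl = λ {v} → irr v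
    }
    where
    dec : Decidable BridgeAdj
    dec (inj₁ x) (inj₁ y) = adj? G₁ x y
    dec (inj₁ x) (inj₂ y) = (x ≟₁ v₁) ×-dec (y ≟₂ v₂)
    dec (inj₂ x) (inj₁ y) = (y ≟₁ v₁) ×-dec (x ≟₂ v₂)
    dec (inj₂ x) (inj₂ y) = adj? G₂ x y

    symm : ∀ x y → BridgeAdj x y → BridgeAdj y x
    symm (inj₁ _) (inj₁ _) e = SimpleGraph.sym G₁ e
    symm (inj₁ _) (inj₂ _) e = e
    symm (inj₂ _) (inj₁ _) e = e
    symm (inj₂ _) (inj₂ _) e = SimpleGraph.sym G₂ e

    irr : ∀ v → ¬ BridgeAdj v v
    irr (inj₁ _) = SimpleGraph.irrefl G₁
    irr (inj₂ _) = SimpleGraph.irrefl G₂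

bridgeWithComplete : ∀ {m} → SimpleGraph (Fin m) → (n : ℕ) →
                     Fin m → Fin n → SimpleGraph (Fin m ⊎ Fin n)
bridgeWithComplete S n v₁ v₂ =
  bridgeSum S (complete n) v₁ v₂ Fin._≟_ Fin._≟_

-- The label set ℤ/Nℤ is Fin N; next is addition of 1 modulo N.
next : ∀ {N} → Fin N → Fin N
next {suc N} i = suc (toℕ i) mod suc N

-- A labeling can only exist if V has exactly N elements.
Labeling : Set → ℕ → Set
Labeling V N = V ↔ Fin N

State : Set → ℕ → Set
State V N = Labeling V N × Fin N

-- Equality of the underlying maps; propositional equality of _↔_ records
-- would also compare the inverses and the proofs of inverseness.
_≈_ : ∀ {V N} → Rel (State V N) 0ℓ
(σ , i) ≈ (τ , j) = (Inverse.to σ ≗ Inverse.to τ) × i ≡ j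

TPro : ∀ {V N} → SimpleGraph V → State V N → State V N
TPro G (σ , i) with adj? G (Inverse.from σ i) (Inverse.from σ (next i))
... | yes _ = σ , next i
... | no  _ = ↔-trans σ (transpose i (next i)) , next i

IsOrbitLength : ∀ {V N} → SimpleGraph V → State V N → ℕ → Set
IsOrbitLength G s k =
  1 ≤ k × iterate (TPro G) s k ≈ s ×
  (∀ j → 1 ≤ j → iterate (TPro G) s j ≈ s → k ≤ j)

restrict : ∀ {V₁ V₂ N} → Labeling (V₁ ⊎ V₂) N → V₁ → Fin N
restrict σ = Inverse.to σ ∘ inj₁

{-# OPTIONS --safe #-}

-- Call σ⁻¹(i) the hand, and list the vertices labeled i + 1, i + 2, … after it. A step of toric
-- promotion then compares the hand with the head of the list: it moves the former to the end of
-- the list and makes the latter the new hand if they are adjacent, and otherwise just moves the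
-- head to the end. So a state returns after k steps exactly when its list of vertices does and
-- N divides k.
--
-- While the hand is in S, the vertices of K are never moved relative to each other and are
-- ignored, except when the hand v₁ meets the bridge end b in K. Then b becomes the hand, and each
-- of the following rounds of N - 1 steps shifts the vertices of K cyclically by one place. Hence
-- v₁ becomes the hand again after exactly n rounds, just when the configuration is the one that
-- ignoring b would have produced: the bridge only causes a delay of n (N - 1) steps. The numbers
-- of delays for two choices b, b′ of the bridge end differ by a coboundary, since v₁ alternates
-- between the two cyclic orders relative to b and b′ each time it passes one of them; so they
-- agree over a period. If the hand is in K initially, running until v₁ becomes the hand
-- leads to configurations for b and b′ that differ by a relabeling of K only.
module Submission where

open import Defs
open import Data.Bool.Base using (Bool; true; false; if_then_else_; _∧_; _∨_)
open import Data.Empty using (⊥; ⊥-elim)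
open import Data.Fin.Base
  using (Fin; zero; suc; toℕ; splitAt; join; combine; funToFin; finToFun)
import Data.Fin.Permutation.Components as Components
import Data.Fin.Properties as Fin
import Data.List.Base as List
open import Data.List.Base
  using (List; []; _∷_; _++_; _∷ʳ_; length; map; mapMaybe; initLast; _∷ʳ′_; zip)
import Data.List.Properties as List
open import Data.List.Properties
  using (++-assoc; ++-identityʳ; ∷ʳ-++; ∷ʳ-injective; length-++; ∷-injective; map-++; map-cong; map-cong-local)
open import Data.List.Membership.Propositional using (_∈_; _∉_)
open import Data.List.Membership.Propositional.Properties
  using (∈-∃++; ∈-++⁺ˡ; ∈-++⁺ʳ; ∈-map⁺)
open import Data.List.Relation.Binary.Permutation.Propositional
  using (_↭_; ↭-refl; ↭-sym; ↭-trans; prep; swap; ↭⇒↭ₛ)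
open import Data.List.Relation.Binary.Permutation.Propositional.Properties
  using (∈-resp-↭; ↭-length; mapMaybe-↭; ∷↭∷ʳ; ++-comm; shift)
import Data.List.Relation.Binary.Permutation.Setoid.Properties as Permutationₛ
open import Data.List.Relation.Binary.Pointwise as Pointwise using (Pointwise; []; _∷_)
open import Data.List.Relation.Unary.All as All using ([]; _∷_)
open import Data.List.Relation.Unary.AllPairs as AllPairs using ([]; _∷_)
open import Data.List.Relation.Unary.Any using (here; there)
open import Data.List.Relation.Unary.Unique.Propositional using (Unique)
open import Data.List.Relation.Unary.Unique.Propositional.Properties
  using (Unique[x∷xs]⇒x∉xs; map⁺)
open import Data.Nat.Base
  using (ℕ; zero; suc; pred; _+_; _*_; _^_; _∸_; _<_; _≤_; s≤s; z≤n)
open import Data.Nat.DivMod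
  using (_/_; _%_; m%n<n; m<n⇒m%n≡m; m%n%n≡m%n; [m+n]%n≡m%n; %-distribˡ-+; m≡m%n+[m/n]*n)
open import Data.Nat.GeneralisedArithmetic using (iterate)
import Data.Nat.Properties as ℕ
open import Data.Nat.Properties
  using ( +-comm; +-assoc; suc-injective; +-cancelʳ-≡; _<?_; ≮⇒≥; ≤-refl; m≤n⇒∃[o]m+o≡n
        ; m+n≤o⇒n≤o; +-commutativeSemigroup)
open import Algebra.Properties.CommutativeSemigroup +-commutativeSemigroup
  using (x∙yz≈y∙xz; xy∙z≈y∙xz)
open import Data.Product.Base using (_×_; _,_; proj₁; proj₂; ∃-syntax)
import Data.Product.Properties as Product
open import Data.Sum using (isInj₂)
open import Data.Sum.Base using (_⊎_; inj₁; inj₂)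
import Data.Sum.Properties as Sum
open import Function.Base using (_∘_; id; flip)
open import Function.Bundles using (Inverse)
open import Level using (0ℓ)
open import Relation.Binary.Core using (Rel)
open import Relation.Binary.Definitions using (Decidable; Symmetric; DecidableEquality)
open import Relation.Binary.PropositionalEquality
  using (_≡_; _≢_; _≗_; refl; sym; trans; cong; cong₂; subst; subst₂; setoid; module ≡-Reasoning)
open import Relation.Nullary using (¬_; Dec; yes; no; does; contradiction)
open import Relation.Nullary.Decidable using (dec-true; dec-false; _×-dec_; map′)

-- Permutations of lists and iteration of maps

Unique-resp-↭ : ∀ {A : Set} {xs ys : List A} → xs ↭ ys → Unique xs → Unique ys
Unique-resp-↭ {A} p = Permutationₛ.Unique-resp-↭ (setoid A) (↭⇒↭ₛ p)

iterate-+ : ∀ {A : Set} (f : A → A) x s t →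
            iterate f x (s + t) ≡ iterate f (iterate f x s) t
iterate-+ f x zero    t = refl
iterate-+ f x (suc s) t = iterate-+ f (f x) s t

iterate-comm : ∀ {A : Set} (f : A → A) x s t →
               iterate f (iterate f x s) t ≡ iterate f (iterate f x t) s
iterate-comm f x s t = begin
  iterate f (iterate f x s) t ≡⟨ iterate-+ f x s t ⟨
  iterate f x (s + t)         ≡⟨ cong (iterate f x) (+-comm s t) ⟩
  iterate f x (t + s)         ≡⟨ iterate-+ f x t s ⟩
  iterate f (iterate f x t) s ∎
  where open ≡-Reasoning

iterate-injective : ∀ {A : Set} {f : A → A} → (∀ {x y} → f x ≡ f y → x ≡ y) →
                    ∀ k {x y} → iterate f x k ≡ iterate f y k → x ≡ y
iterate-injective inj zero    eq = eq
iterate-injective inj (suc k) eq = inj (iterate-injective inj k eq)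

[]≢∷ʳ : ∀ {A : Set} (xs : List A) {x} → [] ≢ xs ∷ʳ x
[]≢∷ʳ []      ()
[]≢∷ʳ (_ ∷ _) ()

-- Configurations and their steps

Config : Set → Set
Config V = V × List V

toList : ∀ {V} → Config V → List V
toList (h , xs) = h ∷ xs

module _ {V : Set} {R : Rel V 0ℓ} (R? : Decidable R) where

  step : Config V → Config V
  step (h , [])     = h , []
  step (h , x ∷ xs) = if does (R? h x) then x , xs ∷ʳ h else h , xs ∷ʳ x

  step-yes : ∀ {h x} xs → R h x → step (h , x ∷ xs) ≡ (x , xs ∷ʳ h)
  step-yes {h} {x} xs r rewrite dec-true (R? h x) r = refl

  step-no : ∀ {h x} xs → ¬ R h x → step (h , x ∷ xs) ≡ (h , xs ∷ʳ x)
  step-no {h} {x} xs ¬r rewrite dec-false (R? h x) ¬r = refl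

  step-↭ : ∀ w → toList (step w) ↭ toList w
  step-↭ (h , [])     = ↭-refl
  step-↭ (h , x ∷ xs) with R? h x
  ... | yes _ = ↭-sym (∷↭∷ʳ h (x ∷ xs))
  ... | no _  = prep h (↭-sym (∷↭∷ʳ x xs))

  -- After a step on a nonempty list, the new hand and the last entry are the two vertices just
  -- compared. By symmetry of `R` their adjacency can still be tested, which reveals the branch
  -- taken, and each branch can be undone.
  step-injective : Symmetric R → ∀ {w w′} → step w ≡ step w′ → w ≡ w′
  step-injective sy {h , []} {h′ , []} eq = eq
  step-injective sy {h , []} {h′ , x′ ∷ xs′} eq with R? h′ x′
  ... | yes _ = contradiction (cong proj₂ eq) ([]≢∷ʳ xs′)
  ... | no _  = contradiction (cong proj₂ eq) ([]≢∷ʳ xs′)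
  step-injective sy {h , x ∷ xs} {h′ , []} eq with R? h x
  ... | yes _ = contradiction (cong proj₂ (sym eq)) ([]≢∷ʳ xs)
  ... | no _  = contradiction (cong proj₂ (sym eq)) ([]≢∷ʳ xs)
  step-injective sy {h , x ∷ xs} {h′ , x′ ∷ xs′} eq with R? h x | R? h′ x′
  ... | yes _ | yes _
    with refl , eq₂ ← Product.,-injective eq
    with refl , refl ← ∷ʳ-injective xs xs′ eq₂ = refl
  ... | yes r | no ¬r
    with refl , eq₂ ← Product.,-injective eq
    with refl , refl ← ∷ʳ-injective xs xs′ eq₂ = contradiction (sy r) ¬r
  ... | no ¬r | yes r
    with refl , eq₂ ← Product.,-injective eq
    with refl , refl ← ∷ʳ-injective xs xs′ eq₂ = contradiction (sy r) ¬r
  ... | no _  | no _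
    with refl , eq₂ ← Product.,-injective eq
    with refl , refl ← ∷ʳ-injective xs xs′ eq₂ = refl

step-cong : ∀ {V : Set} {R R′ : Rel V 0ℓ} (R? : Decidable R) (R′? : Decidable R′) {h x} xs →
            (R h x → R′ h x) → (R′ h x → R h x) →
            step R? (h , x ∷ xs) ≡ step R′? (h , x ∷ xs)
step-cong R? R′? {h} {x} xs f g with R? h x
... | yes r = sym (step-yes R′? xs (f r))
... | no ¬r = sym (step-no R′? xs (¬r ∘ g))

-- Zipped lists as partial bijections

module _ {A B : Set} where

  ∈-zip⁻ˡ : ∀ {x : A} {y : B} xs ys → (x , y) ∈ zip xs ys → x ∈ xs
  ∈-zip⁻ˡ (_ ∷ xs) (_ ∷ ys) (here refl) = here refl
  ∈-zip⁻ˡ (_ ∷ xs) (_ ∷ ys) (there xy∈) = there (∈-zip⁻ˡ xs ys xy∈)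

  ∈-zip⁻ʳ : ∀ {x : A} {y : B} xs ys → (x , y) ∈ zip xs ys → y ∈ ys
  ∈-zip⁻ʳ (_ ∷ xs) (_ ∷ ys) (here refl) = here refl
  ∈-zip⁻ʳ (_ ∷ xs) (_ ∷ ys) (there xy∈) = there (∈-zip⁻ʳ xs ys xy∈)

  zip-functional : ∀ {xs : List A} {ys : List B} → Unique xs → ∀ {x y y′} →
                   (x , y) ∈ zip xs ys → (x , y′) ∈ zip xs ys → y ≡ y′
  zip-functional {_ ∷ _}  {_ ∷ _}  _        (here refl) (here refl)  = refl
  zip-functional {_ ∷ xs} {_ ∷ ys} uniq     (here refl) (there xy′∈) =
    contradiction (∈-zip⁻ˡ xs ys xy′∈) (Unique[x∷xs]⇒x∉xs uniq)
  zip-functional {_ ∷ xs} {_ ∷ ys} uniq     (there xy∈) (here refl)  =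
    contradiction (∈-zip⁻ˡ xs ys xy∈) (Unique[x∷xs]⇒x∉xs uniq)
  zip-functional {_ ∷ _}  {_ ∷ _}  (_ ∷ uniq) (there xy∈) (there xy′∈) = zip-functional uniq xy∈ xy′∈

  zip-injective : ∀ {xs : List A} {ys : List B} → Unique ys → ∀ {x x′ y} →
                  (x , y) ∈ zip xs ys → (x′ , y) ∈ zip xs ys → x ≡ x′
  zip-injective {_ ∷ _}  {_ ∷ _}  _        (here refl) (here refl)  = refl
  zip-injective {_ ∷ xs} {_ ∷ ys} uniq     (here refl) (there x′y∈) =
    contradiction (∈-zip⁻ʳ xs ys x′y∈) (Unique[x∷xs]⇒x∉xs uniq)
  zip-injective {_ ∷ xs} {_ ∷ ys} uniq     (there xy∈) (here refl)  =
    contradiction (∈-zip⁻ʳ xs ys xy∈) (Unique[x∷xs]⇒x∉xs uniq)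
  zip-injective {_ ∷ _}  {_ ∷ _}  (_ ∷ uniq) (there xy∈) (there x′y∈) = zip-injective uniq xy∈ x′y∈

  zip-pointwise : ∀ {xs : List A} {ys : List B} → length xs ≡ length ys →
                  Pointwise (λ x y → (x , y) ∈ zip xs ys) xs ys
  zip-pointwise {[]}    {[]}    _   = []
  zip-pointwise {_ ∷ _} {_ ∷ _} len = here refl ∷ Pointwise.map there (zip-pointwise (suc-injective len))

-- Cyclic order in lists

maj : Bool → Bool → Bool → Bool
maj true  q r = q ∨ r
maj false q r = q ∧ r

module Cyclic {V : Set} (_≟_ : DecidableEquality V) where

  before : V → V → List V → Bool
  before a c []       = false
  before a c (x ∷ xs) = if does (x ≟ a) then true else if does (x ≟ c) then false else before a c xs

  before-here : ∀ a c xs → before a c (a ∷ xs) ≡ true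
  before-here a c xs rewrite dec-true (a ≟ a) refl = refl

  before-here′ : ∀ {a c} xs → a ≢ c → before a c (c ∷ xs) ≡ false
  before-here′ {a} {c} xs a≢c rewrite dec-false (c ≟ a) (a≢c ∘ sym) | dec-true (c ≟ c) refl = refl

  before-skip : ∀ {a c x} xs → x ≢ a → x ≢ c → before a c (x ∷ xs) ≡ before a c xs
  before-skip {a} {c} {x} xs x≢a x≢c rewrite dec-false (x ≟ a) x≢a | dec-false (x ≟ c) x≢c = refl

  before-∷ʳ : ∀ {a c x} xs → x ≢ a → x ≢ c → before a c (xs ∷ʳ x) ≡ before a c xs
  before-∷ʳ []       x≢a x≢c = before-skip [] x≢a x≢c
  before-∷ʳ {a} {c} (y ∷ xs) x≢a x≢c with y ≟ a | y ≟ c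
  ... | yes _ | _     = refl
  ... | no _  | yes _ = refl
  ... | no _  | no _  = before-∷ʳ xs x≢a x≢c

  before-∷ʳ-left : ∀ {a c} xs → a ≢ c → a ∉ xs → c ∈ xs → before a c (xs ∷ʳ a) ≡ false
  before-∷ʳ-left (y ∷ xs) a≢c a∉ (here refl) = before-here′ (xs ∷ʳ _) a≢c
  before-∷ʳ-left {a} {c} (y ∷ xs) a≢c a∉ (there c∈) with y ≟ a | y ≟ c
  ... | yes refl | _     = contradiction (here refl) a∉
  ... | no _     | yes _ = refl
  ... | no _     | no _  = before-∷ʳ-left xs a≢c (a∉ ∘ there) c∈

  before-∷ʳ-right : ∀ {a c} xs → a ∈ xs → c ∉ xs → before a c (xs ∷ʳ c) ≡ true
  before-∷ʳ-right (y ∷ xs) (here refl) c∉ = before-here y _ (xs ∷ʳ _)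
  before-∷ʳ-right {a} {c} (y ∷ xs) (there a∈) c∉ with y ≟ a | y ≟ c
  ... | yes _ | _        = refl
  ... | no _  | yes refl = contradiction (here refl) c∉
  ... | no _  | no _     = before-∷ʳ-right xs a∈ (c∉ ∘ there)

  before-swap : ∀ {a c} x y xs → ¬ (x ≡ a × y ≡ c) → ¬ (x ≡ c × y ≡ a) →
                before a c (x ∷ y ∷ xs) ≡ before a c (y ∷ x ∷ xs)
  before-swap {a} {c} x y xs ¬ac ¬ca with x ≟ a | x ≟ c | y ≟ a | y ≟ c
  ... | yes x≡a | _       | _       | yes y≡c = contradiction (x≡a , y≡c) ¬ac
  ... | _       | yes x≡c | yes y≡a | _       = contradiction (x≡c , y≡a) ¬ca
  ... | yes _   | _       | yes _   | no _    = refl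
  ... | yes _   | yes _   | no _    | no _    = refl
  ... | yes _   | no _    | no _    | no _    = refl
  ... | no _    | yes _   | no _    | yes _   = refl
  ... | no _    | yes _   | no _    | no _    = refl
  ... | no _    | no _    | yes _   | yes _   = refl
  ... | no _    | no _    | yes _   | no _    = refl
  ... | no _    | no _    | no _    | yes _   = refl
  ... | no _    | no _    | no _    | no _    = refl

  -- One or two of the three comparisons hold, two exactly for the cyclic order a, c, e.
  cyclic : V → V → V → List V → Bool
  cyclic a c e xs = maj (before a c xs) (before c e xs) (before e a xs)

  -- If `x` is one of the three vertices, its move to the end reverses the two comparisons that
  -- involve it. One of these was true and the other false, and this remains so; hence the majority
  -- is the third comparison both before and after. If `x` is another vertex, no comparison changes.
  cyclic-rotate : ∀ {a c e} → a ≢ c → c ≢ e → e ≢ a → ∀ x xs → Unique (x ∷ xs) →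
                  a ∈ x ∷ xs → c ∈ x ∷ xs → e ∈ x ∷ xs →
                  cyclic a c e (xs ∷ʳ x) ≡ cyclic a c e (x ∷ xs)
  cyclic-rotate {a} {c} {e} a≢c c≢e e≢a x xs uniq a∈ c∈ e∈ = helper (x ≟ a) (x ≟ c) (x ≟ e)
    where
    x∉xs : x ∉ xs
    x∉xs = Unique[x∷xs]⇒x∉xs uniq

    tail : ∀ {y} → y ≢ x → y ∈ x ∷ xs → y ∈ xs
    tail y≢x (here y≡x) = contradiction y≡x y≢x
    tail y≢x (there y∈) = y∈

    true-false : ∀ q → maj true q false ≡ q
    true-false true  = refl
    true-false false = refl

    false-true : ∀ q → maj false q true ≡ q
    false-true true  = refl
    false-true false = refl

    helper : Dec (x ≡ a) → Dec (x ≡ c) → Dec (x ≡ e) →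
             cyclic a c e (xs ∷ʳ x) ≡ cyclic a c e (x ∷ xs)
    helper (yes refl) _ _
      rewrite before-∷ʳ-left xs a≢c x∉xs (tail (a≢c ∘ sym) c∈)
            | before-∷ʳ-right xs (tail e≢a e∈) x∉xs
            | before-∷ʳ xs a≢c (e≢a ∘ sym)
            | before-here a c xs
            | before-here′ xs e≢a
            | before-skip xs a≢c (e≢a ∘ sym)
      = trans (false-true (before c e xs)) (sym (true-false (before c e xs)))
    helper (no x≢a) (yes refl) _
      rewrite before-∷ʳ-left xs c≢e x∉xs (tail (c≢e ∘ sym) e∈)
            | before-∷ʳ-right xs (tail a≢c a∈) x∉xs
            | before-∷ʳ xs c≢e x≢a
            | before-here c e xs
            | before-here′ xs a≢c
            | before-skip xs c≢e x≢a
      with before e a xs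
    ... | true  = refl
    ... | false = refl
    helper (no x≢a) (no x≢c) (yes refl)
      rewrite before-∷ʳ-left xs e≢a x∉xs (tail (e≢a ∘ sym) a∈)
            | before-∷ʳ-right xs (tail c≢e c∈) x∉xs
            | before-∷ʳ xs x≢a x≢c
            | before-here e a xs
            | before-here′ xs c≢e
            | before-skip xs x≢a x≢c
      with before a c xs
    ... | true  = refl
    ... | false = refl
    helper (no x≢a) (no x≢c) (no x≢e)
      rewrite before-∷ʳ xs x≢a x≢c | before-∷ʳ xs x≢c x≢e | before-∷ʳ xs x≢e x≢a
            | before-skip xs x≢a x≢c | before-skip xs x≢c x≢e | before-skip xs x≢e x≢a
      = refl

-- Bridge sums with a complete graph

module Bridge {m n : ℕ} (S : SimpleGraph (Fin m)) (v : Fin m) where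

  V : Set
  V = Fin m ⊎ Fin n

  _≟_ : DecidableEquality V
  _≟_ = Sum.≡-dec Fin._≟_ Fin._≟_

  cliquePart : List V → List (Fin n)
  cliquePart = mapMaybe isInj₂

  InClique : Config V → Set
  InClique w = ∃[ a ] proj₁ w ≡ inj₂ a

  InBase : Config V → Set
  InBase w = ∃[ s ] proj₁ w ≡ inj₁ s

  T : Fin n → Config V → Config V
  T b = step (adj? (bridgeWithComplete S n v b))

  T-injective : ∀ b {w w′} → T b w ≡ T b w′ → w ≡ w′
  T-injective b = step-injective (adj? G) (λ {x} {y} → SimpleGraph.sym G {x} {y})
    where G = bridgeWithComplete S n v b

  -- Drops the edges of K along with the bridge: `U` is only followed while the hand is in S, where
  -- edges inside K are never tested.
  BaseAdj : Rel V 0ℓ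
  BaseAdj (inj₁ s) (inj₁ t) = Adj S s t
  BaseAdj _        _        = ⊥

  baseAdj? : Decidable BaseAdj
  baseAdj? (inj₁ s) (inj₁ t) = adj? S s t
  baseAdj? (inj₁ s) (inj₂ y) = no λ ()
  baseAdj? (inj₂ x) (inj₁ t) = no λ ()
  baseAdj? (inj₂ x) (inj₂ y) = no λ ()

  U : Config V → Config V
  U = step baseAdj?

  Meets : Fin n → Config V → Set
  Meets b (h , [])     = ⊥
  Meets b (h , x ∷ xs) = h ≡ inj₁ v × x ≡ inj₂ b

  meets? : ∀ b w → Dec (Meets b w)
  meets? b (h , [])     = no id
  meets? b (h , x ∷ xs) = (h ≟ inj₁ v) ×-dec (x ≟ inj₂ b)

  T≡U : ∀ b {w} → InBase w → ¬ Meets b w → T b w ≡ U w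
  T≡U b {_ , []} _ ¬meets = refl
  T≡U b {_ , inj₁ t ∷ xs} (s , refl) ¬meets =
    step-cong (adj? (bridgeWithComplete S n v b)) baseAdj? xs id id
  T≡U b {_ , inj₂ y ∷ xs} (s , refl) ¬meets =
    step-cong (adj? (bridgeWithComplete S n v b)) baseAdj? xs
      (λ { (refl , refl) → ¬meets (refl , refl) }) ⊥-elim

  -- Steps at the bridge and runs with the hand in K

  T-pass : ∀ b a {s} xs → s ≢ v → T b (inj₂ a , inj₁ s ∷ xs) ≡ (inj₂ a , xs ∷ʳ inj₁ s)
  T-pass b a xs s≢v = step-no (adj? (bridgeWithComplete S n v b)) xs (s≢v ∘ proj₁)

  T-pass′ : ∀ {b a s} xs → a ≢ b → T b (inj₂ a , inj₁ s ∷ xs) ≡ (inj₂ a , xs ∷ʳ inj₁ s)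
  T-pass′ {b} xs a≢b = step-no (adj? (bridgeWithComplete S n v b)) xs (a≢b ∘ proj₂)

  T-exit : ∀ b xs → T b (inj₂ b , inj₁ v ∷ xs) ≡ (inj₁ v , xs ∷ʳ inj₂ b)
  T-exit b xs = step-yes (adj? (bridgeWithComplete S n v b)) xs (refl , refl)

  T-enter : ∀ b xs → T b (inj₁ v , inj₂ b ∷ xs) ≡ (inj₂ b , xs ∷ʳ inj₁ v)
  T-enter b xs = step-yes (adj? (bridgeWithComplete S n v b)) xs (refl , refl)

  T-clique : ∀ b a c xs → T b (inj₂ a , inj₂ c ∷ xs) ≡ (inj₂ c , xs ∷ʳ inj₂ a)
  T-clique b a c xs with a Fin.≟ c
  ... | no a≢c = refl
  -- Equal vertices are not adjacent, but then both branches of the step give the same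
  -- configuration.
  ... | yes refl = refl

  -- Truncates the template if there are too few clique vertices to fill it.
  refill : List V → List (Fin n) → List V
  refill []            cs       = []
  refill (inj₁ s ∷ xs) cs       = inj₁ s ∷ refill xs cs
  refill (inj₂ _ ∷ xs) []       = []
  refill (inj₂ _ ∷ xs) (c ∷ cs) = inj₂ c ∷ refill xs cs

  refill-cliquePart : ∀ xs → refill xs (cliquePart xs) ≡ xs
  refill-cliquePart []            = refl
  refill-cliquePart (inj₁ s ∷ xs) = cong (inj₁ s ∷_) (refill-cliquePart xs)
  refill-cliquePart (inj₂ x ∷ xs) = cong (inj₂ x ∷_) (refill-cliquePart xs)

  -- Every configuration but the last must have its hand in K. This records that an excursion into K
  -- does not visit S before its end, which `time-surjective` relies on.
  data CliqueRun (b : Fin n) : Config V → ℕ → Config V → Set where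
    done : ∀ {w} → CliqueRun b w 0 w
    more : ∀ {a xs w t w′} → T b (inj₂ a , xs) ≡ w →
           CliqueRun b w t w′ → CliqueRun b (inj₂ a , xs) (suc t) w′

  _▷_ : ∀ {b w w′ w″ s t} → CliqueRun b w s w′ → CliqueRun b w′ t w″ →
        CliqueRun b w (s + t) w″
  done     ▷ q = q
  more e p ▷ q = more e (p ▷ q)

  run-iterate : ∀ {b w t w′} → CliqueRun b w t w′ → iterate (T b) w t ≡ w′
  run-iterate done          = refl
  run-iterate (more refl p) = run-iterate p

  run-inClique : ∀ {b w t w′} → CliqueRun b w t w′ → ∀ {k} → k < t →
                 InClique (iterate (T b) w k)
  run-inClique (more {a = a} refl p) {zero}  k<t       = a , refl
  run-inClique (more refl p)         {suc k} (s≤s k<t) = run-inClique p k<t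

  -- The hand passes over the vertices of S, none of which is v, and is replaced by each vertex of K
  -- that it meets. So every clique slot of `P` receives the vertex that was in hand on arrival
  -- there: `ds` is `a` followed by all of `cs` but the last, and `d` is left in hand.
  sweep : ∀ b P {a cs ds d} ys → inj₁ v ∉ P → length cs ≡ length (cliquePart P) →
          a ∷ cs ≡ ds ∷ʳ d →
          CliqueRun b (inj₂ a , refill P cs ++ ys) (length P) (inj₂ d , ys ++ refill P ds)
  sweep b [] {a} {[]} {[]} ys v∉P len refl =
    subst (λ zs → CliqueRun b (inj₂ a , ys) 0 (inj₂ a , zs)) (sym (++-identityʳ ys)) done
  sweep b [] {cs = []} {_ ∷ []} ys v∉P len ()
  sweep b [] {cs = []} {_ ∷ _ ∷ _} ys v∉P len ()
  sweep b (inj₁ s ∷ P) {a} {cs} {ds} {d} ys v∉P len eq =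
    more (T-pass b a (refill P cs ++ ys) λ { refl → v∉P (here refl) })
      (subst₂ (λ xs zs → CliqueRun b (inj₂ a , xs) (length P) (inj₂ d , zs))
        (sym (++-assoc (refill P cs) ys _)) (∷ʳ-++ ys (inj₁ s) (refill P ds))
        (sweep b P (ys ∷ʳ inj₁ s) (v∉P ∘ there) len eq))
  sweep b (inj₂ x ∷ P) {a} {c ∷ cs} {[]} {d} ys v∉P len ()
  sweep b (inj₂ x ∷ P) {a} {c ∷ cs} {e ∷ ds} {d} ys v∉P len eq with ∷-injective eq
  ... | refl , eq′ =
    more (T-clique b a c (refill P cs ++ ys))
      (subst₂ (λ xs zs → CliqueRun b (inj₂ c , xs) (length P) (inj₂ d , zs))
        (sym (++-assoc (refill P cs) ys _)) (∷ʳ-++ ys (inj₂ a) (refill P ds))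
        (sweep b P (ys ∷ʳ inj₂ a) (v∉P ∘ there) (suc-injective len) eq′))

  -- One full round, ending with the comparison of the hand with v. The result `w` of that
  -- comparison is a parameter because it depends on whether `d` is the bridge end.
  sweep∷ʳv : ∀ b P {a cs ds d} → inj₁ v ∉ P → length cs ≡ length (cliquePart P) →
             a ∷ cs ≡ ds ∷ʳ d → ∀ {w} → T b (inj₂ d , inj₁ v ∷ refill P ds) ≡ w →
             CliqueRun b (inj₂ a , refill P cs ∷ʳ inj₁ v) (suc (length P)) w
  sweep∷ʳv b P {a} {cs} v∉P len eq {w} e =
    subst (λ t → CliqueRun b (inj₂ a , refill P cs ∷ʳ inj₁ v) t w) (+-comm (length P) 1)
      (sweep b P (inj₁ v ∷ []) v∉P len eq ▷ more e done)

  -- In each sweep the clique vertices shift cyclically by one, so the bridge end is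
  -- the one in hand upon reaching v after one sweep per vertex from the bridge end onwards.
  escape : ∀ b P k ws {us a cs} → length ws ≡ k → inj₁ v ∉ P → length cs ≡ length (cliquePart P) →
           b ∉ ws → a ∷ cs ≡ us ++ b ∷ ws →
           CliqueRun b (inj₂ a , refill P cs ∷ʳ inj₁ v) (suc k * suc (length P))
             (inj₁ v , refill P (ws ++ us) ∷ʳ inj₂ b)
  escape b P zero [] {us} _ v∉P len b∉ws eq =
    sweep∷ʳv b P v∉P len eq (T-exit b _) ▷ done
  escape b P (suc k) ws {us} {a} {cs} lenws v∉P len b∉ws eq with initLast ws
  ... | ws′ ∷ʳ′ d =
    -- The last vertex `d` of `ws` is in hand at v and is not `b`, so v is passed. From then on `d`
    -- leads the cyclic order: it moves from the end of `ws` to the front of `us`.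
    sweep∷ʳv b P v∉P len eq′ (T-pass′ _ λ { refl → b∉ws (∈-++⁺ʳ ws′ (here refl)) })
    ▷ subst (λ zs → CliqueRun b (inj₂ d , refill P (us ++ b ∷ ws′) ∷ʳ inj₁ v)
                 (suc k * suc (length P)) (inj₁ v , refill P zs ∷ʳ inj₂ b))
        (sym (∷ʳ-++ ws′ d us))
        (escape b P k ws′ lenws′ v∉P len′ (b∉ws ∘ ∈-++⁺ˡ) refl)
    where
    eq′ : a ∷ cs ≡ (us ++ b ∷ ws′) ∷ʳ d
    eq′ = trans eq (sym (++-assoc us (b ∷ ws′) _))

    length-∷ʳ : ∀ {A : Set} (xs : List A) y → length (xs ∷ʳ y) ≡ suc (length xs)
    length-∷ʳ xs y = trans (length-++ xs) (+-comm (length xs) 1)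

    lenws′ : length ws′ ≡ k
    lenws′ = suc-injective (trans (sym (length-∷ʳ ws′ d)) lenws)

    len′ : length (us ++ b ∷ ws′) ≡ length (cliquePart P)
    len′ = trans (suc-injective (trans (sym (length-∷ʳ (us ++ b ∷ ws′) d)) (cong length (sym eq′)))) len

  -- For a configuration that lists all N vertices this is n (N - 1). It is read off the
  -- configuration, and `delay-↭` keeps it constant along runs.
  delay : Config V → ℕ
  delay (h , xs) = length (cliquePart (h ∷ xs)) * length xs

  delay-↭ : ∀ w w′ → toList w ↭ toList w′ → delay w ≡ delay w′
  delay-↭ _ _ p = cong₂ _*_ (↭-length (mapMaybe-↭ isInj₂ p)) (suc-injective (↭-length p))

  ∈-cliquePart⁺ : ∀ {b} xs → inj₂ b ∈ xs → b ∈ cliquePart xs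
  ∈-cliquePart⁺ (inj₁ _ ∷ xs) (there b∈)  = ∈-cliquePart⁺ xs b∈
  ∈-cliquePart⁺ (inj₂ _ ∷ xs) (here refl) = here refl
  ∈-cliquePart⁺ (inj₂ _ ∷ xs) (there b∈)  = there (∈-cliquePart⁺ xs b∈)

  ∈-cliquePart⁻ : ∀ {b} xs → b ∈ cliquePart xs → inj₂ b ∈ xs
  ∈-cliquePart⁻ (inj₁ _ ∷ xs) b∈          = there (∈-cliquePart⁻ xs b∈)
  ∈-cliquePart⁻ (inj₂ _ ∷ xs) (here refl) = here refl
  ∈-cliquePart⁻ (inj₂ _ ∷ xs) (there b∈)  = there (∈-cliquePart⁻ xs b∈)

  -- Just after entering, `b` leads the cyclic order of K, so `escape` applies with `us` empty and
  -- makes one round for each vertex of K. All other clique vertices are then back in their own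
  -- slots, and `b` is at the end of the list, where `U` puts it.
  enterRun : ∀ b w → Unique (toList w) → Meets b w → CliqueRun b (T b w) (delay w) (U w)
  enterRun b (_ , _ ∷ xs) (v∉ ∷ b∉ ∷ _) (refl , refl) rewrite T-enter b xs =
    subst₂ (λ ys zs → CliqueRun b (inj₂ b , ys ∷ʳ inj₁ v) (delay (inj₁ v , inj₂ b ∷ xs)) (inj₁ v , zs ∷ʳ inj₂ b))
      (refill-cliquePart xs)
      (trans (cong (refill xs) (++-identityʳ (cliquePart xs))) (refill-cliquePart xs))
      (escape b xs _ (cliquePart xs) {[]} refl
        (λ v∈ → All.lookup v∉ (there v∈) refl) refl
        (λ b∈ → All.lookup b∉ (∈-cliquePart⁻ xs b∈) refl) refl)

  -- Counting the delays at the bridge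

  χ : Fin n → Config V → ℕ
  χ b w = if does (meets? b w) then 1 else 0

  χ-meets : ∀ b w → Meets b w → χ b w ≡ 1
  χ-meets b w meets rewrite dec-true (meets? b w) meets = refl

  χ-¬meets : ∀ b w → ¬ Meets b w → χ b w ≡ 0
  χ-¬meets b w ¬meets rewrite dec-false (meets? b w) ¬meets = refl

  crossings : Fin n → Config V → ℕ → ℕ
  crossings b w zero    = 0
  crossings b w (suc j) = χ b w + crossings b (U w) j

  U-inBase : ∀ w → InBase w → InBase (U w)
  U-inBase (_ , [])          base       = base
  U-inBase (_ , inj₁ t ∷ xs) (s , refl) with adj? S s t
  ... | yes _ = t , refl
  ... | no _  = s , refl
  U-inBase (_ , inj₂ y ∷ xs) (s , refl) = s , refl

  ¬clique×base : ∀ {w} → InClique w → InBase w → ⊥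
  ¬clique×base (_ , refl) (_ , ())

  -- The common delay is a parameter, so that `time` adds the same number at each crossing instead
  -- of a `delay` of each configuration in turn.
  module Tracking (d : ℕ) where

    Good : Config V → Set
    Good w = InBase w × Unique (toList w) × delay w ≡ d

    U-good : ∀ {w} → Good w → Good (U w)
    U-good {w} (base , uniq , eq) =
      U-inBase w base , Unique-resp-↭ (↭-sym (step-↭ baseAdj? w)) uniq ,
      trans (delay-↭ (U w) w (step-↭ baseAdj? w)) eq

    time : Fin n → Config V → ℕ → ℕ
    time b w j = j + crossings b w j * d

    iterate-detour : ∀ b {w} → Good w → Meets b w → ∀ t →
                     iterate (T b) w (suc (d + t)) ≡ iterate (T b) (U w) t
    iterate-detour b {w} (_ , uniq , eq) meets t =
      trans (iterate-+ (T b) (T b w) d t)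
        (cong (λ x → iterate (T b) x t)
          (subst (λ e → iterate (T b) (T b w) e ≡ U w) eq (run-iterate (enterRun b w uniq meets))))

    time-suc-meets : ∀ b {w} j → Meets b w → time b w (suc j) ≡ suc (d + time b (U w) j)
    time-suc-meets b {w} j meets rewrite dec-true (meets? b w) meets =
      cong suc (x∙yz≈y∙xz j d (crossings b (U w) j * d))

    time-suc-¬meets : ∀ b {w} j → ¬ Meets b w → time b w (suc j) ≡ suc (time b (U w) j)
    time-suc-¬meets b {w} j ¬meets rewrite dec-false (meets? b w) ¬meets = refl

    iterate-time : ∀ b {w} → Good w → ∀ j → iterate (T b) w (time b w j) ≡ iterate U w j
    iterate-time b good zero = refl
    iterate-time b {w} good@(base , _) (suc j) with meets? b w
    ... | no ¬meets rewrite T≡U b base ¬meets = iterate-time b (U-good good) j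
    ... | yes meets = begin
      iterate (T b) w (suc (j + (d + crossings b (U w) j * d)))
        ≡⟨ cong (iterate (T b) w ∘ suc) (x∙yz≈y∙xz j d (crossings b (U w) j * d)) ⟩
      iterate (T b) w (suc (d + time b (U w) j))
        ≡⟨ iterate-detour b good meets (time b (U w) j) ⟩
      iterate (T b) (U w) (time b (U w) j)
        ≡⟨ iterate-time b (U-good good) j ⟩
      iterate U (U w) j ∎
      where open ≡-Reasoning

    -- The fuel bounds the recursion, which skips a whole excursion into the clique at once.
    time-surjective : ∀ b fuel k → k ≤ fuel → ∀ {w} → Good w → InBase (iterate (T b) w k) →
                      ∃[ j ] k ≡ time b w j
    time-surjective b fuel zero _ good _ = 0 , refl
    time-surjective b (suc fuel) (suc k) (s≤s k≤fuel) {w} good@(base , uniq , eq) base′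
      with meets? b w
    ... | no ¬meets rewrite T≡U b base ¬meets
      with j , k≡ ← time-surjective b fuel k k≤fuel (U-good good) base′
      = suc j , trans (cong suc k≡) (sym (time-suc-¬meets b j ¬meets))
    ... | yes meets with k <? d
    -- After fewer than `d` steps of the excursion the hand is still in K, contrary to `base′`.
    ...   | yes k<d = ⊥-elim (¬clique×base {w = iterate (T b) (T b w) k}
              (run-inClique (enterRun b w uniq meets) (subst (k <_) (sym eq) k<d)) base′)
    ...   | no k≮d
      with r , refl ← m≤n⇒∃[o]m+o≡n (≮⇒≥ k≮d)
      with j , r≡ ← time-surjective b fuel r (m+n≤o⇒n≤o d k≤fuel) (U-good good)
                      (subst InBase (iterate-detour b good meets r) base′)
      = suc j , trans (cong (λ t → suc (d + t)) r≡) (sym (time-suc-meets b j meets))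

  -- Comparison of two bridge ends with the hand in S

  open Cyclic _≟_

  module Potential {b b′ : Fin n} (b≢b′ : b ≢ b′) where

    -- The potential behind the coboundary: it rises from 0 to 1 when v passes `b`, falls from 1 to
    -- 0 when v passes `b′`, and is otherwise constant under `U`.
    Φ : List V → ℕ
    Φ xs = if cyclic (inj₂ b) (inj₁ v) (inj₂ b′) xs then 1 else 0

    Φ-rotate : ∀ x xs → Unique (x ∷ xs) → inj₂ b ∈ x ∷ xs → inj₁ v ∈ x ∷ xs → inj₂ b′ ∈ x ∷ xs →
               Φ (xs ∷ʳ x) ≡ Φ (x ∷ xs)
    Φ-rotate x xs uniq b∈ v∈ b′∈ =
      cong (if_then 1 else 0)
        (cyclic-rotate (λ ()) (λ ()) (λ { refl → b≢b′ refl }) x xs uniq b∈ v∈ b′∈)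

    Φ-enter : ∀ xs → Φ (inj₁ v ∷ inj₂ b ∷ xs) ≡ 0
    Φ-enter xs
      rewrite before-here′ {inj₂ b} {inj₁ v} (inj₂ b ∷ xs) (λ ())
            | before-here (inj₁ v) (inj₂ b′) (inj₂ b ∷ xs)
            | before-skip {inj₂ b′} {inj₂ b} {inj₁ v} (inj₂ b ∷ xs) (λ ()) (λ ())
            | before-here′ {inj₂ b′} {inj₂ b} xs (λ { refl → b≢b′ refl }) = refl

    Φ-entered : ∀ xs → Φ (inj₂ b ∷ inj₁ v ∷ xs) ≡ 1
    Φ-entered xs
      rewrite before-here (inj₂ b) (inj₁ v) (inj₁ v ∷ xs)
            | before-skip {inj₁ v} {inj₂ b′} {inj₂ b} (inj₁ v ∷ xs) (λ ()) (λ { refl → b≢b′ refl })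
            | before-here (inj₁ v) (inj₂ b′) xs = refl

    Φ-enter′ : ∀ xs → Φ (inj₁ v ∷ inj₂ b′ ∷ xs) ≡ 1
    Φ-enter′ xs
      rewrite before-here′ {inj₂ b} {inj₁ v} (inj₂ b′ ∷ xs) (λ ())
            | before-here (inj₁ v) (inj₂ b′) (inj₂ b′ ∷ xs)
            | before-skip {inj₂ b′} {inj₂ b} {inj₁ v} (inj₂ b′ ∷ xs) (λ ()) (λ ())
            | before-here (inj₂ b′) (inj₂ b) xs = refl

    Φ-entered′ : ∀ xs → Φ (inj₂ b′ ∷ inj₁ v ∷ xs) ≡ 0
    Φ-entered′ xs
      rewrite before-skip {inj₂ b} {inj₁ v} {inj₂ b′} (inj₁ v ∷ xs) (λ { refl → b≢b′ refl }) (λ ())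
            | before-here′ {inj₂ b} {inj₁ v} xs (λ ())
            | before-here′ {inj₁ v} {inj₂ b′} (inj₁ v ∷ xs) (λ ()) = refl

    Φ-swap : ∀ s x xs → ¬ Meets b (inj₁ s , x ∷ xs) → ¬ Meets b′ (inj₁ s , x ∷ xs) →
             Φ (inj₁ s ∷ x ∷ xs) ≡ Φ (x ∷ inj₁ s ∷ xs)
    Φ-swap s x xs ¬meets ¬meets′
      rewrite before-swap {inj₂ b} {inj₁ v} (inj₁ s) x xs (λ { (() , _) }) ¬meets
            | before-swap {inj₁ v} {inj₂ b′} (inj₁ s) x xs ¬meets′ (λ { (() , _) })
            | before-swap {inj₂ b′} {inj₂ b} (inj₁ s) x xs (λ { (() , _) }) (λ { (() , _) }) = refl

    Contains : Config V → Set
    Contains w = inj₂ b ∈ toList w × inj₁ v ∈ toList w × inj₂ b′ ∈ toList w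

    U-contains : ∀ {w} → Contains w → Contains (U w)
    U-contains {w} (b∈ , v∈ , b′∈) = keep b∈ , keep v∈ , keep b′∈
      where
      keep : ∀ {x} → x ∈ toList w → x ∈ toList (U w)
      keep = ∈-resp-↭ (↭-sym (step-↭ baseAdj? w))

    -- Seen on the whole list, hand included, a step of `U` is a rotation if the two vertices are
    -- adjacent, and otherwise a swap of the first two followed by a rotation. Rotations preserve
    -- `Φ`, and since the hand is in S, the swap affects it only when v meets `b` or `b′`.
    χ-Φ : ∀ w → InBase w → Unique (toList w) → Contains w →
          χ b w + Φ (toList w) ≡ χ b′ w + Φ (toList (U w))
    χ-Φ (_ , []) _ _ (here refl , here () , _)
    χ-Φ (_ , x ∷ xs) (s , refl) uniq (b∈ , v∈ , b′∈) = helper x uniq b∈ v∈ b′∈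
      where
      rotate-pass : ∀ x → Unique (inj₁ s ∷ x ∷ xs) → inj₂ b ∈ inj₁ s ∷ x ∷ xs →
               inj₁ v ∈ inj₁ s ∷ x ∷ xs → inj₂ b′ ∈ inj₁ s ∷ x ∷ xs →
               Φ (inj₁ s ∷ xs ∷ʳ x) ≡ Φ (x ∷ inj₁ s ∷ xs)
      rotate-pass x uniq b∈ v∈ b′∈ =
        Φ-rotate x (inj₁ s ∷ xs) (Unique-resp-↭ p uniq)
          (∈-resp-↭ p b∈) (∈-resp-↭ p v∈) (∈-resp-↭ p b′∈)
        where
        p : inj₁ s ∷ x ∷ xs ↭ x ∷ inj₁ s ∷ xs
        p = swap _ _ ↭-refl

      balance : ∀ {k k′ l l′ p q} → k ≡ k′ → l ≡ l′ → k′ + p ≡ l′ + q → k + p ≡ l + q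
      balance refl refl eq = eq

      helper : ∀ x → Unique (inj₁ s ∷ x ∷ xs) → inj₂ b ∈ inj₁ s ∷ x ∷ xs →
               inj₁ v ∈ inj₁ s ∷ x ∷ xs → inj₂ b′ ∈ inj₁ s ∷ x ∷ xs →
               χ b (inj₁ s , x ∷ xs) + Φ (inj₁ s ∷ x ∷ xs) ≡
               χ b′ (inj₁ s , x ∷ xs) + Φ (toList (U (inj₁ s , x ∷ xs)))
      helper (inj₁ t) uniq b∈ v∈ b′∈ with adj? S s t
      ... | yes _ = balance (χ-¬meets b w (λ { (_ , ()) })) (χ-¬meets b′ w λ { (_ , ()) })
        (sym (Φ-rotate (inj₁ s) (inj₁ t ∷ xs) uniq b∈ v∈ b′∈))
        where w = inj₁ s , inj₁ t ∷ xs
      ... | no _  = balance (χ-¬meets b w (λ { (_ , ()) })) (χ-¬meets b′ w λ { (_ , ()) })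
        (trans (Φ-swap s (inj₁ t) xs (λ { (_ , ()) }) (λ { (_ , ()) }))
          (sym (rotate-pass (inj₁ t) uniq b∈ v∈ b′∈)))
        where w = inj₁ s , inj₁ t ∷ xs
      helper (inj₂ y) uniq b∈ v∈ b′∈
        with meets? b (inj₁ s , inj₂ y ∷ xs) | meets? b′ (inj₁ s , inj₂ y ∷ xs)
           | rotate-pass (inj₂ y) uniq b∈ v∈ b′∈
      ... | yes (refl , refl)  | yes (_ , refl)       | _  = contradiction refl b≢b′
      ... | yes m@(refl , refl) | no ¬meets′          | eq = balance (χ-meets b (inj₁ s , inj₂ y ∷ xs) m) (χ-¬meets b′ (inj₁ s , inj₂ y ∷ xs) ¬meets′)
        (trans (cong suc (Φ-enter xs)) (sym (trans eq (Φ-entered xs))))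
      ... | no ¬meets          | yes m@(refl , refl)  | eq = balance (χ-¬meets b (inj₁ s , inj₂ y ∷ xs) ¬meets) (χ-meets b′ (inj₁ s , inj₂ y ∷ xs) m)
        (trans (Φ-enter′ xs) (cong suc (sym (trans eq (Φ-entered′ xs)))))
      ... | no ¬meets          | no ¬meets′           | eq = balance (χ-¬meets b (inj₁ s , inj₂ y ∷ xs) ¬meets) (χ-¬meets b′ (inj₁ s , inj₂ y ∷ xs) ¬meets′)
        (trans (Φ-swap s (inj₂ y) xs ¬meets ¬meets′) (sym eq))

    -- The telescoping sum of `χ-Φ` along the run of `U`.
    crossings-Φ : ∀ j w → InBase w → Unique (toList w) → Contains w →
                  crossings b w j + Φ (toList w) ≡ crossings b′ w j + Φ (toList (iterate U w j))
    crossings-Φ zero    w _ _ _ = refl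
    crossings-Φ (suc j) w base uniq cont = begin
      (χ b w + c) + Φ (toList w)      ≡⟨ xy∙z≈y∙xz (χ b w) c _ ⟩
      c + (χ b w + Φ (toList w))      ≡⟨ cong (c +_) (χ-Φ w base uniq cont) ⟩
      c + (χ b′ w + Φ (toList (U w))) ≡⟨ x∙yz≈y∙xz c (χ b′ w) _ ⟩
      χ b′ w + (c + Φ (toList (U w)))
        ≡⟨ cong (χ b′ w +_) (crossings-Φ j (U w) (U-inBase w base)
             (Unique-resp-↭ (↭-sym (step-↭ baseAdj? w)) uniq) (U-contains {w} cont)) ⟩
      χ b′ w + (c′ + Φ (toList (iterate U (U w) j))) ≡⟨ +-assoc (χ b′ w) c′ _ ⟨
      (χ b′ w + c′) + Φ (toList (iterate U (U w) j)) ∎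
      where
      open ≡-Reasoning
      c c′ : ℕ
      c  = crossings b (U w) j
      c′ = crossings b′ (U w) j

    -- As the hand is in S at time `k`, this time is `time b w j` for some `j`, and `j` steps of `U`
    -- lead back to `w`. The potentials at both ends then cancel, the crossing numbers agree, and
    -- `k` is `time b′ w j` as well.
    base-period : ∀ k w → InBase w → Unique (toList w) → Contains w →
                  iterate (T b) w k ≡ w → iterate (T b′) w k ≡ w
    base-period k w base uniq cont Tᵏw≡w
      with j , k≡ ← Tracking.time-surjective (delay w) b k k ≤-refl {w} (base , uniq , refl) (subst InBase (sym Tᵏw≡w) base)
      = begin
      iterate (T b′) w k             ≡⟨ cong (iterate (T b′) w) (trans k≡ (cong (λ c → j + c * delay w) same)) ⟩
      iterate (T b′) w (time b′ w j) ≡⟨ iterate-time b′ {w} (base , uniq , refl) j ⟩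
      iterate U w j                  ≡⟨ Uʲw≡w ⟩
      w ∎
      where
      open ≡-Reasoning
      open Tracking (delay w)
      Uʲw≡w : iterate U w j ≡ w
      Uʲw≡w = trans (sym (iterate-time b {w} (base , uniq , refl) j))
                (trans (cong (iterate (T b) w) (sym k≡)) Tᵏw≡w)
      same : crossings b w j ≡ crossings b′ w j
      same = +-cancelʳ-≡ (Φ (toList w)) _ _
        (trans (crossings-Φ j w base uniq cont)
          (cong (λ x → crossings b′ w j + Φ (toList x)) Uʲw≡w))

  -- Relabelings of K

  Matching : Rel (Fin n) 0ℓ → Set
  Matching E = (∀ {x y y′} → E x y → E x y′ → y ≡ y′) × (∀ {x x′ y} → E x y → E x′ y → x ≡ x′)

  matching-flip : ∀ {E} → Matching E → Matching (flip E)
  matching-flip (fun , inj) = (λ e e′ → inj e e′) , (λ e e′ → fun e e′)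

  -- Relabelings are relations rather than functions, because both sources provide them in this
  -- form: the zip of two lists in `clique-period` and the comparison of two labelings in
  -- `transfer`.
  data Lift (E : Rel (Fin n) 0ℓ) : Rel V 0ℓ where
    base   : ∀ {s} → Lift E (inj₁ s) (inj₁ s)
    clique : ∀ {x y} → E x y → Lift E (inj₂ x) (inj₂ y)

  LiftConfig : Rel (Fin n) 0ℓ → Rel (Config V) 0ℓ
  LiftConfig E w w′ = Lift E (proj₁ w) (proj₁ w′) × Pointwise (Lift E) (proj₂ w) (proj₂ w′)

  -- Injectivity of a relabeling is enough for the edges inside K, since K is complete; `E b b′`
  -- carries bridge to bridge.
  lift-adj : ∀ {E b b′} → Matching E → E b b′ → ∀ {h h′ x x′} → Lift E h h′ → Lift E x x′ →
             Adj (bridgeWithComplete S n v b) h x → Adj (bridgeWithComplete S n v b′) h′ x′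
  lift-adj _ _ base base adj = adj
  lift-adj (fun , _) e base (clique e′) (refl , refl) = refl , fun e′ e
  lift-adj (fun , _) e (clique e′) base (refl , refl) = refl , fun e′ e
  lift-adj (_ , inj) e (clique e₁) (clique e₂) x≢y refl = x≢y (inj e₁ e₂)

  lift-flip : ∀ {E x y} → Lift E x y → Lift (flip E) y x
  lift-flip base       = base
  lift-flip (clique e) = clique e

  module _ {E : Rel (Fin n) 0ℓ} {b b′} (match : Matching E) (e : E b b′) where

    T-lift : ∀ {w w′} → LiftConfig E w w′ → LiftConfig E (T b w) (T b′ w′)
    T-lift (eh , []) = eh , []
    T-lift {h , x ∷ xs} {h′ , x′ ∷ xs′} (eh , ex ∷ es)
      with adj? (bridgeWithComplete S n v b) h x | adj? (bridgeWithComplete S n v b′) h′ x′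
    ... | yes _ | yes _  = ex , Pointwise.++⁺ es (eh ∷ [])
    ... | no _  | no _   = eh , Pointwise.++⁺ es (ex ∷ [])
    ... | yes r | no ¬r  = contradiction (lift-adj match e eh ex r) ¬r
    ... | no ¬r | yes r  = contradiction (lift-adj (matching-flip match) e (lift-flip eh) (lift-flip ex) r) ¬r

    iterate-lift : ∀ k {w w′} → LiftConfig E w w′ →
                   LiftConfig E (iterate (T b) w k) (iterate (T b′) w′ k)
    iterate-lift zero    ew = ew
    iterate-lift (suc k) ew = iterate-lift k (T-lift ew)

    lift-functional : ∀ {x y y′} → Lift E x y → Lift E x y′ → y ≡ y′
    lift-functional base       base        = refl
    lift-functional (clique e) (clique e′) = cong inj₂ (proj₁ match e e′)

    pointwise-functional : ∀ {xs ys ys′} → Pointwise (Lift E) xs ys → Pointwise (Lift E) xs ys′ → ys ≡ ys′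
    pointwise-functional []       []         = refl
    pointwise-functional (e ∷ es) (e′ ∷ es′) = cong₂ _∷_ (lift-functional e e′) (pointwise-functional es es′)

    -- The relabeling commutes with the steps, so `w′` and its `k`-th iterate are both partners of
    -- `w`, and partners are unique.
    lift-period : ∀ k {w w′} → LiftConfig E w w′ → iterate (T b) w k ≡ w → iterate (T b′) w′ k ≡ w′
    lift-period k {w} {w′} ew Tᵏw≡w
      with eh , es ← subst (λ u → LiftConfig E u _) Tᵏw≡w (iterate-lift k ew)
      = cong₂ _,_ (lift-functional eh (proj₁ ew)) (pointwise-functional es (proj₂ ew))

  -- Leaving K when the hand starts there

  Unique-cliquePart : ∀ xs → Unique xs → Unique (cliquePart xs)
  Unique-cliquePart []            []          = []
  Unique-cliquePart (inj₁ _ ∷ xs) (_ ∷ uniq)  = Unique-cliquePart xs uniq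
  Unique-cliquePart (inj₂ x ∷ xs) (x∉ ∷ uniq) =
    All.tabulate (λ y∈ x≡y → All.lookup x∉ (∈-cliquePart⁻ xs y∈) (cong inj₂ x≡y))
      ∷ Unique-cliquePart xs uniq

  -- The template `Q` and the vertices `ks` are to be shared by all bridge ends. Exits for two of
  -- them then differ only in the order of the clique vertices, hence by a relabeling.
  Exits : Fin n → Config V → List V → List (Fin n) → Set
  Exits b w Q ks = ∃[ t ] ∃[ cs ] b ∷ cs ↭ ks ×
                   iterate (T b) w t ≡ (inj₁ v , refill Q cs ∷ʳ inj₂ b)

  exits : ∀ b d Q → Unique (inj₂ d ∷ inj₁ v ∷ Q) → b ∈ d ∷ cliquePart Q →
          Exits b (inj₂ d , inj₁ v ∷ Q) Q (d ∷ cliquePart Q)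
  exits b d Q uniq b∈ with d Fin.≟ b
  ... | yes refl = 1 , cliquePart Q , ↭-refl ,
          trans (T-exit b Q) (cong (λ xs → inj₁ v , xs ∷ʳ inj₂ b) (sym (refill-cliquePart Q)))
  ... | no d≢b with us , ws , eq ← ∈-∃++ b∈ =
          -- One step passes v; then there is one round for each vertex of `ws`, and a last one that
          -- ends with `b` in hand at v.
          suc (suc (length ws) * suc (length Q)) , ws ++ us , b∷ws++us↭ ,
          trans (cong (λ w → iterate (T b) w (suc (length ws) * suc (length Q))) first)
            (run-iterate (escape b Q (length ws) ws refl v∉Q refl b∉ws eq))
    where
    first : T b (inj₂ d , inj₁ v ∷ Q) ≡ (inj₂ d , refill Q (cliquePart Q) ∷ʳ inj₁ v)
    first = trans (T-pass′ Q d≢b) (cong (λ xs → inj₂ d , xs ∷ʳ inj₁ v) (sym (refill-cliquePart Q)))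

    v∉Q : inj₁ v ∉ Q
    v∉Q = Unique[x∷xs]⇒x∉xs (AllPairs.tail uniq)

    b∷ws++us↭ : b ∷ ws ++ us ↭ d ∷ cliquePart Q
    b∷ws++us↭ = subst (b ∷ ws ++ us ↭_) (sym eq) (++-comm (b ∷ ws) us)

    b∉ws : b ∉ ws
    b∉ws = Unique[x∷xs]⇒x∉xs
      (Unique-resp-↭ (↭-sym b∷ws++us↭) (Unique-cliquePart (inj₂ d ∷ inj₁ v ∷ Q) uniq)) ∘ ∈-++⁺ˡ

  iterate-T-↭ : ∀ b k w → toList (iterate (T b) w k) ↭ toList w
  iterate-T-↭ b zero    w = ↭-refl
  iterate-T-↭ b (suc k) w =
    ↭-trans (iterate-T-↭ b k (T b w)) (step-↭ (adj? (bridgeWithComplete S n v b)) w)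

  snoc-view : ∀ {A : Set} (x : A) xs → ∃[ ys ] ∃[ y ] x ∷ xs ≡ ys ∷ʳ y
  snoc-view x []        = [] , x , refl
  snoc-view x (x′ ∷ xs) with ys , y , eq ← snoc-view x′ xs = x ∷ ys , y , cong (x ∷_) eq

  -- Until v is first met, with the hand in K, steps are the same for every bridge end. So a single
  -- sweep over the part `X` before v leads all of them to one configuration, where `exits` takes
  -- over.
  clique-exits : ∀ a xs → Unique (inj₂ a ∷ xs) → inj₁ v ∈ xs →
    ∃[ Q ] ∃[ ks ] Unique ks × (∀ b → inj₂ b ∈ inj₂ a ∷ xs → Exits b (inj₂ a , xs) Q ks)
  clique-exits a xs uniq v∈xs
    with X , Y , refl ← ∈-∃++ v∈xs
    with ds , d , eq ← snoc-view a (cliquePart X)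
    = Q , d ∷ cliquePart Q , Unique-cliquePart (inj₂ d ∷ inj₁ v ∷ Q) uniq-Q , exit
    where
    Q : List V
    Q = Y ++ refill X ds

    v∉X : inj₁ v ∉ X
    v∉X = Unique[x∷xs]⇒x∉xs (Unique-resp-↭ (shift (inj₁ v) X Y) (AllPairs.tail uniq)) ∘ ∈-++⁺ˡ

    sweep-X : ∀ b → iterate (T b) (inj₂ a , X ++ inj₁ v ∷ Y) (length X) ≡ (inj₂ d , inj₁ v ∷ Q)
    sweep-X b = run-iterate
      (subst (λ Z → CliqueRun b (inj₂ a , Z ++ inj₁ v ∷ Y) (length X) (inj₂ d , inj₁ v ∷ Q))
        (refill-cliquePart X) (sweep b X (inj₁ v ∷ Y) v∉X refl eq))

    ↭-X : ∀ b → inj₂ d ∷ inj₁ v ∷ Q ↭ inj₂ a ∷ X ++ inj₁ v ∷ Y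
    ↭-X b = subst (λ w → toList w ↭ _) (sweep-X b) (iterate-T-↭ b (length X) (inj₂ a , X ++ inj₁ v ∷ Y))

    uniq-Q : Unique (inj₂ d ∷ inj₁ v ∷ Q)
    -- The permutation comes from a run, for which any bridge end will do; `a` is available.
    uniq-Q = Unique-resp-↭ (↭-sym (↭-X a)) uniq

    exit : ∀ b → inj₂ b ∈ inj₂ a ∷ X ++ inj₁ v ∷ Y → Exits b (inj₂ a , X ++ inj₁ v ∷ Y) Q (d ∷ cliquePart Q)
    exit b b∈
      with t , cs , p , eq′ ← exits b d Q uniq-Q
             (∈-cliquePart⁺ (inj₂ d ∷ inj₁ v ∷ Q) (∈-resp-↭ (↭-sym (↭-X b)) b∈))
      = length X + t , cs , p ,
        trans (iterate-+ (T b) (inj₂ a , X ++ inj₁ v ∷ Y) (length X) t)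
          (trans (cong (λ w → iterate (T b) w t) (sweep-X b)) eq′)

  refill-lift : ∀ {E} Q {cs cs′} → Pointwise E cs cs′ → Pointwise (Lift E) (refill Q cs) (refill Q cs′)
  refill-lift []           es       = []
  refill-lift (inj₁ _ ∷ Q) es       = base ∷ refill-lift Q es
  refill-lift (inj₂ _ ∷ Q) []       = []
  refill-lift (inj₂ _ ∷ Q) (e ∷ es) = clique e ∷ refill-lift Q es

  -- The period is carried forward along `T b` to the exit, across to the exit for `b′` by the
  -- relabeling, and back to `w` by injectivity of `T b′`. The exit times `t` and `t′` may differ.
  clique-period : ∀ {b b′} k w → InClique w → Unique (toList w) →
                  inj₂ b ∈ toList w → inj₁ v ∈ toList w → inj₂ b′ ∈ toList w →
                  iterate (T b) w k ≡ w → iterate (T b′) w k ≡ w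
  clique-period {b} {b′} k w@(_ , xs) (a , refl) uniq b∈ (there v∈) b′∈ Tᵏw≡w
    with Q , ks , uniq-ks , exit ← clique-exits a xs uniq v∈
    with t  , cs  , p  , eq  ← exit b b∈
    with t′ , cs′ , p′ , eq′ ← exit b′ b′∈
    = iterate-injective (T-injective b′) t′
        (trans (iterate-comm (T b′) w k t′)
          (subst (λ u → iterate (T b′) u k ≡ u) (sym eq′)
            (lift-period match (here refl) k lifted
              (subst (λ u → iterate (T b) u k ≡ u) eq
                (trans (iterate-comm (T b) w t k) (cong (λ u → iterate (T b) u t) Tᵏw≡w))))))
    where
    E : Rel (Fin n) 0ℓ
    E x y = (x , y) ∈ zip (b ∷ cs) (b′ ∷ cs′)

    match : Matching E
    match = zip-functional (Unique-resp-↭ (↭-sym p) uniq-ks) ,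
            zip-injective (Unique-resp-↭ (↭-sym p′) uniq-ks)

    lifted : LiftConfig E (inj₁ v , refill Q cs ∷ʳ inj₂ b) (inj₁ v , refill Q cs′ ∷ʳ inj₂ b′)
    lifted = base , Pointwise.++⁺
      (refill-lift Q (Pointwise.map there
        (zip-pointwise (suc-injective (trans (↭-length p) (sym (↭-length p′)))))))
      (clique (here refl) ∷ [])

  bridge-period : ∀ b b′ k w → Unique (toList w) →
                  inj₂ b ∈ toList w → inj₁ v ∈ toList w → inj₂ b′ ∈ toList w →
                  iterate (T b) w k ≡ w → iterate (T b′) w k ≡ w
  bridge-period b b′ k w@(h , _) uniq b∈ v∈ b′∈ Tᵏw≡w with b Fin.≟ b′ | h
  ... | yes refl | _      = Tᵏw≡w
  ... | no b≢b′  | inj₁ s = Potential.base-period b≢b′ k _ (s , refl) uniq (b∈ , v∈ , b′∈) Tᵏw≡w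
  ... | no _     | inj₂ a = clique-period k _ (a , refl) uniq b∈ v∈ b′∈ Tᵏw≡w

-- The cycle of labels

[m%d+n]%d≡[m+n]%d : ∀ m n d → (m % suc d + n) % suc d ≡ (m + n) % suc d
[m%d+n]%d≡[m+n]%d m n d = begin
  (m % suc d + n) % suc d                 ≡⟨ %-distribˡ-+ (m % suc d) n (suc d) ⟩
  (m % suc d % suc d + n % suc d) % suc d ≡⟨ cong (λ r → (r + n % suc d) % suc d) (m%n%n≡m%n m (suc d)) ⟩
  (m % suc d + n % suc d) % suc d         ≡⟨ %-distribˡ-+ m n (suc d) ⟨
  (m + n) % suc d                         ∎
  where open ≡-Reasoning

toℕ-iterate-next : ∀ {L} (i : Fin (suc L)) k → toℕ (iterate next i k) ≡ (toℕ i + k) % suc L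
toℕ-iterate-next i zero = sym (trans (cong (_% _) (ℕ.+-identityʳ (toℕ i))) (m<n⇒m%n≡m (Fin.toℕ<n i)))
toℕ-iterate-next {L} i (suc k) = begin
  toℕ (iterate next (next i) k)      ≡⟨ toℕ-iterate-next (next i) k ⟩
  (toℕ (next i) + k) % suc L         ≡⟨ cong (λ t → (t + k) % suc L) (Fin.toℕ-fromℕ< (m%n<n (suc (toℕ i)) (suc L))) ⟩
  (suc (toℕ i) % suc L + k) % suc L  ≡⟨ [m%d+n]%d≡[m+n]%d (suc (toℕ i)) k L ⟩
  (suc (toℕ i) + k) % suc L          ≡⟨ cong (_% suc L) (ℕ.+-suc (toℕ i) k) ⟨
  (toℕ i + suc k) % suc L            ∎
  where open ≡-Reasoning

next-cycle : ∀ {L} (i : Fin (suc L)) → iterate next i (suc L) ≡ i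
next-cycle {L} i = Fin.toℕ-injective (begin
  toℕ (iterate next i (suc L)) ≡⟨ toℕ-iterate-next i (suc L) ⟩
  (toℕ i + suc L) % suc L      ≡⟨ [m+n]%n≡m%n (toℕ i) (suc L) ⟩
  toℕ i % suc L                ≡⟨ m<n⇒m%n≡m (Fin.toℕ<n i) ⟩
  toℕ i                        ∎)
  where open ≡-Reasoning

next-injective : ∀ {N} {i j : Fin N} → next i ≡ next j → i ≡ j
next-injective {suc L} {i} {j} eq =
  -- After one `next`, `L` further ones complete the cycle.
  trans (sym (next-cycle i)) (trans (cong (λ k → iterate next k L) eq) (next-cycle j))

-- Otherwise `suc k` would be a multiple of `suc L`, although it lies between 1 and `L`.
iterate-next-≢ : ∀ {L} (i : Fin (suc L)) k → k < L → iterate next i (suc k) ≢ i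
iterate-next-≢ {L} i k k<L eq = absurd q (ℕ.+-cancelˡ-≡ (toℕ i) _ _ (begin
  toℕ i + suc k                                  ≡⟨ m≡m%n+[m/n]*n (toℕ i + suc k) (suc L) ⟩
  (toℕ i + suc k) % suc L + q * suc L            ≡⟨ cong (_+ q * suc L) (toℕ-iterate-next i (suc k)) ⟨
  toℕ (iterate next i (suc k)) + q * suc L       ≡⟨ cong (λ j → toℕ j + q * suc L) eq ⟩
  toℕ i + q * suc L                              ∎))
  where
  open ≡-Reasoning
  q : ℕ
  q = (toℕ i + suc k) / suc L
  absurd : ∀ q → suc k ≢ q * suc L
  absurd (suc q) eq = ℕ.<⇒≢ (ℕ.<-≤-trans (s≤s k<L) (ℕ.m≤m+n (suc L) (q * suc L))) eq

∈-iterate⁻ : ∀ {A : Set} {f : A → A} {x y} l → y ∈ List.iterate f x l → ∃[ k ] k < l × y ≡ iterate f x k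
∈-iterate⁻ (suc l) (here refl) = 0 , s≤s z≤n , refl
∈-iterate⁻ (suc l) (there y∈) with k , k<l , eq ← ∈-iterate⁻ l y∈ = suc k , s≤s k<l , eq

∈-iterate⁺ : ∀ {A : Set} {f : A → A} {x} {k l} → k < l → iterate f x k ∈ List.iterate f x l
∈-iterate⁺ {k = zero}  (s≤s _)   = here refl
∈-iterate⁺ {k = suc k} (s≤s k<l) = there (∈-iterate⁺ k<l)

iterate-∷ʳ : ∀ {A : Set} (f : A → A) x l → List.iterate f x (suc l) ≡ List.iterate f x l ∷ʳ iterate f x l
iterate-∷ʳ f x zero    = refl
iterate-∷ʳ f x (suc l) = cong (x ∷_) (iterate-∷ʳ f (f x) l)

cycle-∷ʳ : ∀ {L} (i : Fin (suc (suc L))) →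
           List.iterate next (next (next i)) (suc L) ≡ List.iterate next (next (next i)) L ∷ʳ i
cycle-∷ʳ {L} i = trans (iterate-∷ʳ next (next (next i)) L) (cong (List.iterate next (next (next i)) L ∷ʳ_) (next-cycle i))

∈-cycle : ∀ {N} (i j : Fin N) → j ∈ List.iterate next i N
∈-cycle {suc L} i j = subst (_∈ List.iterate next i (suc L)) (Fin.toℕ-injective (begin
  toℕ (iterate next i (k % suc L))  ≡⟨ toℕ-iterate-next i (k % suc L) ⟩
  (toℕ i + k % suc L) % suc L       ≡⟨ cong (_% suc L) (+-comm (toℕ i) (k % suc L)) ⟩
  (k % suc L + toℕ i) % suc L       ≡⟨ [m%d+n]%d≡[m+n]%d k (toℕ i) L ⟩
  (toℕ j + (suc L ∸ toℕ i) + toℕ i) % suc L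
    ≡⟨ cong (_% suc L) (trans (+-assoc (toℕ j) _ (toℕ i)) (cong (toℕ j +_) (ℕ.m∸n+n≡m (ℕ.<⇒≤ (Fin.toℕ<n i))))) ⟩
  (toℕ j + suc L) % suc L           ≡⟨ [m+n]%n≡m%n (toℕ j) (suc L) ⟩
  toℕ j % suc L                     ≡⟨ m<n⇒m%n≡m (Fin.toℕ<n j) ⟩
  toℕ j                             ∎))
  (∈-iterate⁺ (m%n<n k (suc L)))
  where
  open ≡-Reasoning
  k : ℕ
  -- The difference of the labels, with one full turn added so that truncated subtraction is
  -- harmless; it is reduced modulo `suc L` where it is used.
  k = toℕ j + (suc L ∸ toℕ i)

Unique-cycle : ∀ {N} (i : Fin N) l → l ≤ N → Unique (List.iterate next i l)
Unique-cycle i zero _ = []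
Unique-cycle {suc L} i (suc l) (s≤s l≤L) =
  All.tabulate distinct ∷ Unique-cycle (next i) l (ℕ.m≤n⇒m≤1+n l≤L)
  where
  distinct : ∀ {j} → j ∈ List.iterate next (next i) l → i ≢ j
  distinct j∈ i≡j with k , k<l , eq ← ∈-iterate⁻ l j∈ =
    iterate-next-≢ i k (ℕ.<-≤-trans k<l l≤L) (sym (trans i≡j eq))

transpose-left : ∀ {N} (i j : Fin N) → Components.transpose i j i ≡ j
transpose-left i j rewrite dec-true (i Fin.≟ i) refl = refl

transpose-right : ∀ {N} (i j : Fin N) → Components.transpose i j j ≡ i
transpose-right i j with j Fin.≟ i
... | yes j≡i = j≡i
... | no _ rewrite dec-true (j Fin.≟ j) refl = refl

transpose-other : ∀ {N} {i j k : Fin N} → k ≢ i → k ≢ j → Components.transpose i j k ≡ k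
transpose-other {i = i} {j} {k} k≢i k≢j rewrite dec-false (k Fin.≟ i) k≢i | dec-false (k Fin.≟ j) k≢j = refl

-- Toric promotion as a step on configurations

module _ {V : Set} where

  reading : ∀ {N} → State V N → Config V
  reading {N} (σ , i) = Inverse.from σ i , map (Inverse.from σ) (List.iterate next (next i) (pred N))

  toList-reading : ∀ {N} (σ : Labeling V N) i →
                   toList (reading (σ , i)) ≡ map (Inverse.from σ) (List.iterate next i N)
  toList-reading {suc L} σ i = refl

  from-injective : ∀ {N} (σ : Labeling V N) {i j} → Inverse.from σ i ≡ Inverse.from σ j → i ≡ j
  from-injective σ eq =
    trans (sym (Inverse.strictlyInverseˡ σ _)) (trans (cong (Inverse.to σ) eq) (Inverse.strictlyInverseˡ σ _))

  to-injective : ∀ {N} (σ : Labeling V N) {x y} → Inverse.to σ x ≡ Inverse.to σ y → x ≡ y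
  to-injective σ eq =
    trans (sym (Inverse.strictlyInverseʳ σ _)) (trans (cong (Inverse.from σ) eq) (Inverse.strictlyInverseʳ σ _))

  Unique-reading : ∀ {N} (s : State V N) → Unique (toList (reading s))
  Unique-reading {N} (σ , i) =
    subst Unique (sym (toList-reading σ i)) (map⁺ (from-injective σ) (Unique-cycle i N ≤-refl))

  ∈-reading : ∀ {N} (s : State V N) x → x ∈ toList (reading s)
  ∈-reading (σ , i) x = subst (x ∈_) (sym (toList-reading σ i))
    (subst (_∈ _) (Inverse.strictlyInverseʳ σ x) (∈-map⁺ (Inverse.from σ) (∈-cycle i (Inverse.to σ x))))

  from-≗ : ∀ {N} (σ τ : Labeling V N) → Inverse.to σ ≗ Inverse.to τ → Inverse.from σ ≗ Inverse.from τ
  from-≗ σ τ eq j = to-injective τ (begin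
    Inverse.to τ (Inverse.from σ j) ≡⟨ eq (Inverse.from σ j) ⟨
    Inverse.to σ (Inverse.from σ j) ≡⟨ Inverse.strictlyInverseˡ σ j ⟩
    j                               ≡⟨ Inverse.strictlyInverseˡ τ j ⟨
    Inverse.to τ (Inverse.from τ j) ∎)
    where open ≡-Reasoning

  reading-cong : ∀ {N} (s t : State V N) → s ≈ t → reading s ≡ reading t
  reading-cong (σ , _) (τ , _) (eq , refl) =
    cong₂ _,_ (from-≗ σ τ eq _) (map-cong (from-≗ σ τ eq) _)

  -- With its starting label known, the reading lists the values of the inverse labeling at all
  -- labels, and these determine the labeling.
  reading-injective : ∀ {N} (s t : State V N) → reading s ≡ reading t → proj₂ s ≡ proj₂ t → s ≈ t
  reading-injective (σ , i) (τ , i) eq refl = to-≗ , refl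
    where
    map-≡ : ∀ {js} → map (Inverse.from σ) js ≡ map (Inverse.from τ) js →
            ∀ {j} → j ∈ js → Inverse.from σ j ≡ Inverse.from τ j
    map-≡ e (here refl) = proj₁ (∷-injective e)
    map-≡ e (there j∈)  = map-≡ (proj₂ (∷-injective e)) j∈

    to-≗ : Inverse.to σ ≗ Inverse.to τ
    to-≗ x = from-injective τ (begin
      Inverse.from τ (Inverse.to σ x)
        ≡⟨ map-≡ (trans (sym (toList-reading σ i)) (trans (cong toList eq) (toList-reading τ i)))
             (∈-cycle i (Inverse.to σ x)) ⟨
      Inverse.from σ (Inverse.to σ x) ≡⟨ Inverse.strictlyInverseʳ σ x ⟩
      x                               ≡⟨ Inverse.strictlyInverseʳ τ x ⟨
      Inverse.from τ (Inverse.to τ x) ∎)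
      where open ≡-Reasoning

  module _ (G : SimpleGraph V) where

    proj₂-TPro : ∀ {N} (s : State V N) → proj₂ (TPro G s) ≡ next (proj₂ s)
    proj₂-TPro (σ , i) with adj? G (Inverse.from σ i) (Inverse.from σ (next i))
    ... | yes _ = refl
    ... | no _  = refl

    -- The current label advances to `next i`. If the labels stay, the list is rotated by one place.
    -- If they are swapped, the hand takes the label `next i` and so stays in hand, while the other
    -- vertex takes `i`, now the last label of the cycle.
    reading-TPro : ∀ {N} (s : State V N) → reading (TPro G s) ≡ step (adj? G) (reading s)
    -- With one vertex, `next i` is `i` and the list is empty on both sides.
    reading-TPro {1} (σ , zero) with adj? G (Inverse.from σ zero) (Inverse.from σ zero)
    ... | yes _ = refl
    ... | no _  = refl
    reading-TPro {suc (suc L)} (σ , i) with adj? G (Inverse.from σ i) (Inverse.from σ (next i))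
    ... | yes _ = cong (Inverse.from σ (next i) ,_)
      (trans (cong (map (Inverse.from σ)) (cycle-∷ʳ i)) (map-++ (Inverse.from σ) (List.iterate next (next (next i)) L) _))
    ... | no _ = cong₂ _,_ (cong (Inverse.from σ) (transpose-left (next i) i))
      (begin
        map (Inverse.from σ ∘ exchange) (List.iterate next (next (next i)) (suc L))
          ≡⟨ cong (map (Inverse.from σ ∘ exchange)) (cycle-∷ʳ i) ⟩
        map (Inverse.from σ ∘ exchange) (rest ∷ʳ i)
          ≡⟨ map-++ (Inverse.from σ ∘ exchange) rest _ ⟩
        map (Inverse.from σ ∘ exchange) rest ∷ʳ Inverse.from σ (exchange i)
          ≡⟨ cong₂ _∷ʳ_ (map-cong-local (All.tabulate λ j∈ → cong (Inverse.from σ) (fixed j∈)))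
               (cong (Inverse.from σ) (transpose-right (next i) i)) ⟩
        map (Inverse.from σ) rest ∷ʳ Inverse.from σ (next i) ∎)
      where
      open ≡-Reasoning
      exchange : Fin (suc (suc L)) → Fin (suc (suc L))
      -- The inverse direction of `transpose i (next i)`, which has the two arguments exchanged.
      exchange = Components.transpose (next i) i
      rest : List (Fin (suc (suc L)))
      rest = List.iterate next (next (next i)) L
      uniq : Unique (i ∷ next i ∷ rest)
      uniq = Unique-cycle i (suc (suc L)) ≤-refl
      fixed : ∀ {j} → j ∈ rest → exchange j ≡ j
      fixed j∈ = transpose-other
        (λ { refl → Unique[x∷xs]⇒x∉xs (AllPairs.tail uniq) j∈ })
        (λ { refl → Unique[x∷xs]⇒x∉xs uniq (there j∈) })

    proj₂-iterate : ∀ {N} k (s : State V N) → proj₂ (iterate (TPro G) s k) ≡ iterate next (proj₂ s) k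
    proj₂-iterate zero    s = refl
    proj₂-iterate (suc k) s =
      trans (proj₂-iterate k (TPro G s)) (cong (λ i → iterate next i k) (proj₂-TPro s))

    reading-iterate : ∀ {N} k (s : State V N) → reading (iterate (TPro G) s k) ≡ iterate (step (adj? G)) (reading s) k
    reading-iterate zero    s = refl
    reading-iterate (suc k) s =
      trans (reading-iterate k (TPro G s)) (cong (λ w → iterate (step (adj? G)) w k) (reading-TPro s))

    ≈⇒period : ∀ {N} k (s : State V N) → iterate (TPro G) s k ≈ s →
               iterate (step (adj? G)) (reading s) k ≡ reading s × iterate next (proj₂ s) k ≡ proj₂ s
    ≈⇒period k s eq =
      trans (sym (reading-iterate k s)) (reading-cong (iterate (TPro G) s k) s eq) , trans (sym (proj₂-iterate k s)) (proj₂ eq)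

    period⇒≈ : ∀ {N} k (s : State V N) →
               iterate (step (adj? G)) (reading s) k ≡ reading s → iterate next (proj₂ s) k ≡ proj₂ s →
               iterate (TPro G) s k ≈ s
    period⇒≈ k s eq eq′ =
      reading-injective (iterate (TPro G) s k) s (trans (reading-iterate k s) eq) (trans (proj₂-iterate k s) eq′)

    -- The first `a` steps cancel on readings and on current labels separately, as `step` and `next`
    -- are injective for propositional equality.
    repeat⇒≈ : ∀ {N} a d (s : State V N) → iterate (TPro G) s a ≈ iterate (TPro G) s (d + a) →
               iterate (TPro G) s d ≈ s
    repeat⇒≈ a d s eq = period⇒≈ d s
      (sym (iterate-injective (step-injective (adj? G) (SimpleGraph.sym G)) a (begin
        iterate (step (adj? G)) (reading s) a       ≡⟨ reading-iterate a s ⟨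
        reading (iterate (TPro G) s a)              ≡⟨ reading-cong (iterate (TPro G) s a) (iterate (TPro G) s (d + a)) eq ⟩
        reading (iterate (TPro G) s (d + a))        ≡⟨ reading-iterate (d + a) s ⟩
        iterate (step (adj? G)) (reading s) (d + a) ≡⟨ iterate-+ (step (adj? G)) (reading s) d a ⟩
        iterate (step (adj? G)) (iterate (step (adj? G)) (reading s) d) a ∎)))
      (sym (iterate-injective next-injective a (begin
        iterate next (proj₂ s) a             ≡⟨ proj₂-iterate a s ⟨
        proj₂ (iterate (TPro G) s a)         ≡⟨ proj₂ eq ⟩
        proj₂ (iterate (TPro G) s (d + a))   ≡⟨ proj₂-iterate (d + a) s ⟩
        iterate next (proj₂ s) (d + a)       ≡⟨ iterate-+ next (proj₂ s) d a ⟩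
        iterate next (iterate next (proj₂ s) d) a ∎)))
      where open ≡-Reasoning

-- Finiteness of the state space and orbit lengths

module _ {m n : ℕ} where

  _≈?_ : ∀ {N} (s t : State (Fin m ⊎ Fin n) N) → Dec (s ≈ t)
  s ≈? t = map′ (λ (eq , eq′) → reading-injective s t eq eq′) (λ eq → reading-cong s t eq , proj₂ eq)
    (Product.≡-dec _≟_ (List.≡-dec _≟_) (reading s) (reading t) ×-dec (proj₂ s Fin.≟ proj₂ t))
    where _≟_ = Sum.≡-dec Fin._≟_ Fin._≟_

  -- Embeds states up to `≈` into a finite set for the pigeonhole principle; only the forward map of
  -- the labeling is encoded, as `≈` compares nothing else of it.
  code : ∀ {N} → State (Fin m ⊎ Fin n) N → Fin (N ^ (m + n) * N)
  code (σ , i) = combine (funToFin (Inverse.to σ ∘ splitAt m)) i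

  code-injective : ∀ {N} (s t : State (Fin m ⊎ Fin n) N) → code s ≡ code t → s ≈ t
  code-injective (σ , i) (τ , j) eq
    with f≡g , i≡j ← Fin.combine-injective (funToFin (Inverse.to σ ∘ splitAt m)) i
                       (funToFin (Inverse.to τ ∘ splitAt m)) j eq
    = to-≗ , i≡j
    where
    open ≡-Reasoning
    to-≗ : Inverse.to σ ≗ Inverse.to τ
    to-≗ x = begin
      Inverse.to σ x                                                  ≡⟨ cong (Inverse.to σ) (Fin.splitAt-join m n x) ⟨
      Inverse.to σ (splitAt m (join m n x))                           ≡⟨ Fin.finToFun-funToFin (Inverse.to σ ∘ splitAt m) _ ⟨
      finToFun (funToFin (Inverse.to σ ∘ splitAt m)) (join m n x)     ≡⟨ cong (λ f → finToFun f (join m n x)) f≡g ⟩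
      finToFun (funToFin (Inverse.to τ ∘ splitAt m)) (join m n x)     ≡⟨ Fin.finToFun-funToFin (Inverse.to τ ∘ splitAt m) _ ⟩
      Inverse.to τ (splitAt m (join m n x))                           ≡⟨ cong (Inverse.to τ) (Fin.splitAt-join m n x) ⟩
      Inverse.to τ x                                                  ∎

  recurs : ∀ {N} (G : SimpleGraph (Fin m ⊎ Fin n)) (s : State (Fin m ⊎ Fin n) N) →
           ∃[ k ] iterate (TPro G) s (suc k) ≈ s
  recurs G s
    -- One more iterate is taken than there are codes.
    with a , b , a<b , eq ← Fin.pigeonhole ≤-refl (λ k → code (iterate (TPro G) s (toℕ k)))
    with d , d+a≡b ← ℕ.m≤n⇒∃[o]m+o≡n a<b
    = d , repeat⇒≈ G (toℕ a) (suc d) s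
            (subst (λ t → iterate (TPro G) s (toℕ a) ≈ iterate (TPro G) s t)
              (trans (sym d+a≡b) (cong suc (+-comm (toℕ a) d)))
              (code-injective (iterate (TPro G) s (toℕ a)) (iterate (TPro G) s (toℕ b)) eq))

least : ∀ {P : ℕ → Set} → (∀ k → Dec (P k)) → ∀ k → P k → ∃[ l ] P l × (∀ j → P j → l ≤ j)
least P? k p with P? 0
... | yes p₀ = 0 , p₀ , λ _ _ → z≤n
least P? zero    p | no ¬p₀ = contradiction p ¬p₀
least P? (suc k) p | no ¬p₀ with l , q , min ← least (P? ∘ suc) k p =
  suc l , q , λ { zero p₀ → contradiction p₀ ¬p₀ ; (suc j) pⱼ → s≤s (min j pⱼ) }

orbit-length : ∀ {m n N} (G : SimpleGraph (Fin m ⊎ Fin n)) (s : State (Fin m ⊎ Fin n) N) →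
               ∃[ k ] IsOrbitLength G s k
orbit-length G s
  with k , p ← recurs G s
  -- The search is over `k` with return time `suc k`, which excludes the trivial return after 0
  -- steps.
  with l , q , min ← least (λ k → iterate (TPro G) s (suc k) ≈? s) k p
  = suc l , s≤s z≤n , q , λ { (suc j) _ pⱼ → s≤s (min j pⱼ) }

-- Two changes in succession: first, under the labeling `σ`, the bridge end moves from `v₂` to the
-- vertex `b` whose label in `σ` is that of `v₂′` in `σ′`, by `bridge-period`. Then the vertices
-- with equal labels are identified, which turns `b` into `v₂′` and `σ` into `σ′`, by `lift-period`.
transfer : ∀ {m n} (S : SimpleGraph (Fin m)) v i v₂ v₂′ (σ σ′ : Labeling (Fin m ⊎ Fin n) (m + n)) →
           restrict σ ≗ restrict σ′ → ∀ k →
           iterate (TPro (bridgeWithComplete S n v v₂)) (σ , i) k ≈ (σ , i) →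
           iterate (TPro (bridgeWithComplete S n v v₂′)) (σ′ , i) k ≈ (σ′ , i)
transfer {m} {n} S v i v₂ v₂′ σ σ′ same k returns =
  period⇒≈ (bridgeWithComplete S n v v₂′) k (σ′ , i) (moved (lift-to (inj₂ v₂′))) (proj₂ periodic)
  where
  open Bridge S v

  E : Rel (Fin n) 0ℓ
  E x y = Inverse.to σ (inj₂ x) ≡ Inverse.to σ′ (inj₂ y)

  match : Matching E
  match = (λ e e′ → Sum.inj₂-injective (to-injective σ′ (trans (sym e) e′))) ,
          (λ e e′ → Sum.inj₂-injective (to-injective σ (trans e (sym e′))))

  lift-to : ∀ y → Lift E (Inverse.from σ (Inverse.to σ′ y)) y
  lift-to (inj₁ s) = subst (λ x → Lift E x (inj₁ s))
    (sym (trans (cong (Inverse.from σ) (sym (same s))) (Inverse.strictlyInverseʳ σ (inj₁ s)))) base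
  lift-to (inj₂ y) with Inverse.from σ (Inverse.to σ′ (inj₂ y))
                      | Inverse.strictlyInverseˡ σ (Inverse.to σ′ (inj₂ y))
  -- Since the labelings agree on S, `σ′` would give one label to both `s` and `y`.
  ... | inj₁ s | eq = contradiction (to-injective σ′ (trans (sym (same s)) eq)) λ ()
  ... | inj₂ x | eq = clique eq

  lift-from : ∀ j → Lift E (Inverse.from σ j) (Inverse.from σ′ j)
  lift-from j = subst (λ l → Lift E (Inverse.from σ l) (Inverse.from σ′ j))
    (Inverse.strictlyInverseˡ σ′ j) (lift-to (Inverse.from σ′ j))

  periodic = ≈⇒period (bridgeWithComplete S n v v₂) k (σ , i) returns

  -- With a general `x` in place of the value of `Inverse.from σ`, a match on `clique` yields the
  -- intermediate bridge end `b`.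
  moved : ∀ {x} → Lift E x (inj₂ v₂′) →
          iterate (T v₂′) (reading (σ′ , i)) k ≡ reading (σ′ , i)
  moved (clique {b} e) = lift-period match e k
    (lift-from i , Pointwise.map⁺ _ _ (Pointwise.refl (λ {j} → lift-from j)))
    (bridge-period v₂ b k (reading (σ , i)) (Unique-reading (σ , i))
      (∈-reading (σ , i) _) (∈-reading (σ , i) _) (∈-reading (σ , i) _) (proj₁ periodic))

theorem6 : (n m : ℕ) (S : SimpleGraph (Fin m)) (v₁ : Fin m) (i : Fin (m + n))
    (v₂ v₂′ : Fin n) (σ σ′ : Labeling (Fin m ⊎ Fin n) (m + n)) →
    restrict σ ≗ restrict σ′ →
    ∃[ k ] (IsOrbitLength (bridgeWithComplete S n v₁ v₂) (σ , i) k × IsOrbitLength (bridgeWithComplete S n v₁ v₂′) (σ′ , i) k)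
theorem6 n m S v₁ i v₂ v₂′ σ σ′ same
  with k , orbit@(1≤k , returns , minimal) ← orbit-length (bridgeWithComplete S n v₁ v₂) (σ , i)
  = k , orbit , 1≤k , transfer S v₁ i v₂ v₂′ σ σ′ same k returns ,
    -- Return times transfer in both directions, so the least ones agree.
    λ j 1≤j returns′ → minimal j 1≤j (transfer S v₁ i v₂′ v₂ σ′ σ (sym ∘ same) j returns′)
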